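{- Let $\alpha>0$. Suppose that the weighted multigraph $G'$ differs from the weighted multigraph $G$ in a $(k,t)$ edge only, with weight increment $\Delta\varepsilon_{kt}=\varepsilon\neq 0$. Then for every $i,j\in V(G)$, $$q'_{ij}-q_{ij}=\frac{\alpha\,(q_{ik}-q_{it})(q_{jt}-q_{jk})}{\rho_{kt}+\varepsilon^{ -1}}.$$
   Context: A weighted multigraph $G$ has finite vertex set $V(G)=\{1,\ldots,n\}$; multiple edges are allowed, loops are not, and all edge weights are strictly positive. Its Laplacian matrix $L=L(G)=(\ell_{ij})$ is given by: for $j\ne i$, $\ell_{ij}$ is minus the sum of the weights of all edges with terminal vertices $i$ and $j$; and $\ell_{ii}=-\sum_{j\neq i}\ell_{ij}$. For a fixed parameter $\alpha>0$, the relative forest accessibility matrix is $Q=(q_{ij})=(I+\alpha L)^{ -1}$, and the adjusted forest distance is $\rho_{ij}=\alpha(q_{ii}+q_{jj}-q_{ij}-q_{ji})$. For $k\neq t$, a weighted multigraph $G'$ (on the same vertex set) differs from $G$ in a $(k,t)$ edge only, with $\Delta\varepsilon_{kt}=\varepsilon\neq0$, if $G'$ is obtained from $G$ by increasing the weight of some edge between $k$ and $t$ by $\varepsilon$, or by adding a new edge between $k$ and $t$ with weight $\varepsilon$ (when $\varepsilon>0$), or by removing an edge between $k$ and $t$ with weight $-\varepsilon$ (when $\varepsilon<0$). Unprimed quantities refer to $G$ and primed quantities refer to $G'$, with the same $\alpha$. -}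

module Defs where

open import Algebra.Apartness.Bundles using (HeytingCommutativeRing; HeytingField)
open import Algebra.Bundles using (CommutativeRing)
import Algebra.Apartness.Properties.HeytingCommutativeRing as HeytingProperties
import Algebra.Definitions as AlgebraDefinitions
import Algebra.Properties.Ring as RingProperties
import Algebra.Properties.Semiring.Sum as SemiringSum
open import Data.Bool.Base using (true; false; if_then_else_)
open import Data.Empty using (⊥-elim)
open import Data.Fin.Base using (Fin; zero; suc)
open import Data.Fin.Properties using (_≟_; suc-injective)
open import Data.List.Base using (List; []; _∷_; filter; foldr; map)
open import Data.List.Properties using (filter-≐)
open import Data.List.Relation.Binary.Permutation.Homogeneous using (Permutation)
open import Data.Nat.Base using (ℕ; zero; suc)
open import Data.Product.Base using (_×_; _,_; Σ-syntax; proj₁; proj₂)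
open import Data.Sum.Base using (_⊎_; inj₁; inj₂; swap)
open import Level using (_⊔_) renaming (suc to lsuc)
open import Relation.Binary.Core using (Rel)
open import Relation.Binary.PropositionalEquality.Core as ≡ using (_≡_; _≢_)
import Relation.Binary.Reasoning.Setoid as SetoidReasoning
open import Relation.Binary.Structures using (IsStrictPartialOrder)
open import Relation.Nullary.Decidable using (Dec; yes; no; does; _×-dec_; _⊎-dec_)
open import Relation.Nullary.Negation using (contradiction)

-- The scalars.  The axioms hold for the real numbers, both classically (where
-- _#_ is ≢) and constructively; apartness is used for "is nonzero" because it
-- is what makes a constructive real invertible.
record OrderedField c ℓ₁ ℓ₂ ℓ₃ : Set (lsuc (c ⊔ ℓ₁ ⊔ ℓ₂ ⊔ ℓ₃)) where
  field
    heytingField : HeytingField c ℓ₁ ℓ₂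

  open HeytingField heytingField public hiding (zero)

  infix 4 _<_
  field
    _<_                  : Rel Carrier ℓ₃
    isStrictPartialOrder : IsStrictPartialOrder _≈_ _<_
    #⇒<⊎>                : ∀ {x y} → x # y → x < y ⊎ y < x
    <⇒#                  : ∀ {x y} → x < y → x # y
    +-monoˡ-<            : ∀ {x y} z → x < y → x + z < y + z
    *-pos                : ∀ {x y} → 0# < x → 0# < y → 0# < x * y

  open CommutativeRing (HeytingCommutativeRing.commutativeRing heytingCommutativeRing) public
    using (ring; semiring)
  open HeytingProperties heytingCommutativeRing public
    using (x-0≈x; 1#0)

  recip : ∀ x → x # 0# → Carrier
  recip x x#0 = proj₁ (#⇒invertible x#0)

  recip-inverseˡ : ∀ {x} (x#0 : x # 0#) → recip x x#0 * x ≈ 1#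
  recip-inverseˡ {x} x#0 =
    trans (*-congˡ (sym (x-0≈x x))) (proj₁ (proj₂ (#⇒invertible x#0)))

module Matrices {c ℓ₁ ℓ₂ ℓ₃} (K : OrderedField c ℓ₁ ℓ₂ ℓ₃) where

  open OrderedField K

  Matrix : ℕ → Set c
  Matrix n = Fin n → Fin n → Carrier

  open SemiringSum semiring
    using (sum-syntax)

  infix  4 _≋_
  infixl 6 _⊕_
  infixr 7 _·_
  infixl 7 _⊗_

  _≋_ : ∀ {n} → Rel (Matrix n) ℓ₁
  A ≋ B = ∀ i j → A i j ≈ B i j

  𝟙 : ∀ {n} → Matrix n
  𝟙 i j = if does (i ≟ j) then 1# else 0#

  _⊕_ : ∀ {n} → Matrix n → Matrix n → Matrix n
  (A ⊕ B) i j = A i j + B i j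

  _·_ : ∀ {n} → Carrier → Matrix n → Matrix n
  (x · A) i j = x * A i j

  _⊗_ : ∀ {n} → Matrix n → Matrix n → Matrix n
  _⊗_ {n} A B i j = ∑[ k < n ] (A i k * B k j)

  Invertible : ∀ {n} → Matrix n → Set (c ⊔ ℓ₁)
  Invertible {n} = AlgebraDefinitions.Invertible (_≋_ {n}) 𝟙 _⊗_

module Multigraphs {c ℓ₁ ℓ₂ ℓ₃} (K : OrderedField c ℓ₁ ℓ₂ ℓ₃) where

  open OrderedField K
  open Matrices K
  open SemiringSum semiring
    using (sum; sum-syntax; sum-cong-≋; ∑-distrib-+; ∑-comm; *-distribˡ-sum; *-distribʳ-sum)

  -- Edges are undirected: the names src and tgt carry no orientation, see
  -- Joins and _≈ᴱ_.
  record Edge (n : ℕ) : Set (c ⊔ ℓ₃) where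
    field
      src tgt  : Fin n
      loopless : src ≢ tgt
      weight   : Carrier
      positive : 0# < weight

  open Edge public

  Joins : ∀ {n} → Edge n → Fin n → Fin n → Set
  Joins e i j = (src e ≡ i × tgt e ≡ j) ⊎ (src e ≡ j × tgt e ≡ i)

  joins? : ∀ {n} (i j : Fin n) (e : Edge n) → Dec (Joins e i j)
  joins? i j e = ((src e ≟ i) ×-dec (tgt e ≟ j)) ⊎-dec ((src e ≟ j) ×-dec (tgt e ≟ i))

  _≈ᴱ_ : ∀ {n} → Rel (Edge n) ℓ₁
  e ≈ᴱ f = Joins e (src f) (tgt f) × weight e ≈ weight f

  -- The multiset of edges of a weighted multigraph on the vertex set Fin n,
  -- listed in some order.
  Multigraph : ℕ → Set (c ⊔ ℓ₃)
  Multigraph n = List (Edge n)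

  infix 4 _≈ᴳ_
  _≈ᴳ_ : ∀ {n} → Rel (Multigraph n) (c ⊔ ℓ₁ ⊔ ℓ₃)
  _≈ᴳ_ = Permutation _≈ᴱ_

  totalWeight : ∀ {n} → List (Edge n) → Carrier
  totalWeight es = foldr _+_ 0# (map weight es)

  offDiagonal : ∀ {n} → Multigraph n → Matrix n
  offDiagonal G i j = - totalWeight (filter (joins? i j) G)

  laplacian : ∀ {n} → Multigraph n → Matrix n
  laplacian {n} G i j =
    if does (i ≟ j)
    then - (∑[ k < n ] (if does (i ≟ k) then 0# else offDiagonal G i k))
    else offDiagonal G i j

  data DiffersInEdge {n} (k t : Fin n) (ε : Carrier) (G G′ : Multigraph n)
       : Set (c ⊔ ℓ₁ ⊔ ℓ₃) where
    reweight : ∀ {e e′ rest} → Joins e k t → Joins e′ k t → weight e′ ≈ weight e + ε →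
               G ≈ᴳ e ∷ rest → G′ ≈ᴳ e′ ∷ rest → DiffersInEdge k t ε G G′
    add      : ∀ {e} → 0# < ε → Joins e k t → weight e ≈ ε →
               G′ ≈ᴳ e ∷ G → DiffersInEdge k t ε G G′
    remove   : ∀ {e} → ε < 0# → Joins e k t → weight e ≈ - ε →
               G ≈ᴳ e ∷ G′ → DiffersInEdge k t ε G G′

  -- I + αL is a symmetric, strictly row-dominant matrix with nonpositive
  -- off-diagonal entries.  Such a matrix is inverted by Gaussian elimination
  -- without pivoting: the Schur complement of its first entry is again
  -- strictly row-dominant with nonpositive off-diagonal entries.
  module Inversion where
    open IsStrictPartialOrder isStrictPartialOrder
      using (<-respˡ-≈; <-respʳ-≈) renaming (trans to <-trans; irrefl to <-irrefl)
    open RingProperties ring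
      using (-‿distribˡ-*; -‿distribʳ-*; -‿involutive; -0#≈0#; -‿+-comm; x[y-z]≈xy-xz; [y-z]x≈yx-zx)
    open SetoidReasoning setoid

    Vector : ℕ → Set c
    Vector n = Fin n → Carrier

    NonNeg : Carrier → Set (ℓ₁ ⊔ ℓ₃)
    NonNeg x = 0# < x ⊎ 0# ≈ x

    <0⇒0<- : ∀ {x} → x < 0# → 0# < - x
    <0⇒0<- {x} x<0 =
      <-respˡ-≈ (-‿inverseʳ x) (<-respʳ-≈ (+-identityˡ (- x)) (+-monoˡ-< (- x) x<0))

    0<⇒-<0 : ∀ {x} → 0# < x → - x < 0#
    0<⇒-<0 {x} 0<x =
      <-respʳ-≈ (-‿inverseʳ x) (<-respˡ-≈ (+-identityˡ (- x)) (+-monoˡ-< (- x) 0<x))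

    0<1 : 0# < 1#
    0<1 with #⇒<⊎> 1#0
    ... | inj₂ 0<1 = 0<1
    ... | inj₁ 1<0 = <-respʳ-≈ eq (*-pos (<0⇒0<- 1<0) (<0⇒0<- 1<0))
      where
      eq : - 1# * - 1# ≈ 1#
      eq = begin
        - 1# * - 1#    ≈⟨ -‿distribˡ-* 1# (- 1#) ⟨
        - (1# * - 1#)  ≈⟨ -‿cong (*-identityˡ (- 1#)) ⟩
        - - 1#         ≈⟨ -‿involutive 1# ⟩
        1#             ∎

    pos+pos : ∀ {x y} → 0# < x → 0# < y → 0# < x + y
    pos+pos {x} {y} 0<x 0<y =
      <-trans 0<y (<-respˡ-≈ (+-identityˡ y) (+-monoˡ-< y 0<x))

    pos+nonNeg : ∀ {x y} → 0# < x → NonNeg y → 0# < x + y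
    pos+nonNeg 0<x (inj₁ 0<y) = pos+pos 0<x 0<y
    pos+nonNeg {x} 0<x (inj₂ 0≈y) =
      <-respʳ-≈ (trans (sym (+-identityʳ x)) (+-congˡ 0≈y)) 0<x

    nonNeg-resp : ∀ {x y} → x ≈ y → NonNeg x → NonNeg y
    nonNeg-resp x≈y (inj₁ 0<x) = inj₁ (<-respʳ-≈ x≈y 0<x)
    nonNeg-resp x≈y (inj₂ 0≈x) = inj₂ (trans 0≈x x≈y)

    nonNeg+nonNeg : ∀ {x y} → NonNeg x → NonNeg y → NonNeg (x + y)
    nonNeg+nonNeg (inj₁ 0<x) y≥0 = inj₁ (pos+nonNeg 0<x y≥0)
    nonNeg+nonNeg {x} {y} (inj₂ 0≈x) y≥0 =
      nonNeg-resp (trans (sym (+-identityˡ y)) (+-congʳ 0≈x)) y≥0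

    nonNeg*nonNeg : ∀ {x y} → NonNeg x → NonNeg y → NonNeg (x * y)
    nonNeg*nonNeg (inj₁ 0<x) (inj₁ 0<y) = inj₁ (*-pos 0<x 0<y)
    nonNeg*nonNeg {x} _ (inj₂ 0≈y) = inj₂ (trans (sym (zeroʳ x)) (*-congˡ 0≈y))
    nonNeg*nonNeg {_} {y} (inj₂ 0≈x) _ = inj₂ (trans (sym (zeroˡ y)) (*-congʳ 0≈x))

    pos⇒#0 : ∀ {x} → 0# < x → x # 0#
    pos⇒#0 0<x = #-sym (<⇒# 0<x)

    inverse-pos : ∀ {x y} → y * x ≈ 1# → 0# < x → 0# < y
    inverse-pos {x} {y} yx≈1 0<x with #⇒<⊎> y#0
      where
      y#0 : y # 0#
      y#0 = invertible⇒# (x , trans (*-congˡ (x-0≈x y)) (trans (*-comm x y) yx≈1)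
                            , trans (*-congʳ (x-0≈x y)) yx≈1)
    ... | inj₂ 0<y = 0<y
    ... | inj₁ y<0 = ⊥-elim (<-irrefl refl (<-trans 0<-1 (0<⇒-<0 0<1)))
      where
      0<-1 : 0# < - 1#
      0<-1 = <-respʳ-≈ (trans (sym (-‿distribˡ-* y x)) (-‿cong yx≈1))
                       (*-pos (<0⇒0<- y<0) 0<x)

    sum-neg : ∀ {n} (f : Vector n) → ∑[ i < n ] (- f i) ≈ - sum f
    sum-neg {zero}  f = sym -0#≈0#
    sum-neg {suc n} f = trans (+-congˡ (sum-neg (λ i → f (suc i)))) (-‿+-comm _ _)

    sum-zero : ∀ n → ∑[ i < n ] 0# ≈ 0#
    sum-zero zero    = refl
    sum-zero (suc n) = trans (+-identityˡ _) (sum-zero n)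

    sum-nonNeg : ∀ {n} (f : Vector n) → (∀ i → NonNeg (f i)) → NonNeg (sum f)
    sum-nonNeg {zero}  f f≥0 = inj₂ refl
    sum-nonNeg {suc n} f f≥0 =
      nonNeg+nonNeg (f≥0 zero) (sum-nonNeg (λ i → f (suc i)) (λ i → f≥0 (suc i)))

    x-y+y : ∀ x y → (x - y) + y ≈ x
    x-y+y x y = begin
      (x - y) + y    ≈⟨ +-assoc x (- y) y ⟩
      x + (- y + y)  ≈⟨ +-congˡ (-‿inverseˡ y) ⟩
      x + 0#         ≈⟨ +-identityʳ x ⟩
      x              ∎

    x+y-y : ∀ x y → (x + y) - y ≈ x
    x+y-y x y = begin
      (x + y) - y    ≈⟨ +-assoc x y (- y) ⟩
      x + (y - y)    ≈⟨ +-congˡ (-‿inverseʳ y) ⟩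
      x + 0#         ≈⟨ +-identityʳ x ⟩
      x              ∎

    record Dominant {n} (A : Matrix n) : Set (ℓ₁ ⊔ ℓ₃) where
      field
        offDiag≤0 : ∀ {i j} → i ≢ j → NonNeg (- A i j)
        rowSum>0  : ∀ i → 0# < sum (A i)

    module Eliminate {n} (A : Matrix (suc n)) (dom : Dominant A) where
      open Dominant dom

      a : Carrier
      a = A zero zero

      b col : Vector n
      b j = A zero (suc j)
      col i = A (suc i) zero

      -Σb≥0 : NonNeg (- sum b)
      -Σb≥0 = nonNeg-resp (sum-neg b) (sum-nonNeg (λ j → - b j) (λ j → offDiag≤0 (λ ())))

      0<a : 0# < a
      0<a = <-respʳ-≈ (x+y-y a (sum b)) (pos+nonNeg (rowSum>0 zero) -Σb≥0)

      abstract
        p : Carrier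
        p = recip a (pos⇒#0 0<a)

        pa≈1 : p * a ≈ 1#
        pa≈1 = recip-inverseˡ (pos⇒#0 0<a)

        0<p : 0# < p
        0<p = inverse-pos pa≈1 0<a

      m : Vector n
      m i = col i * p

      -m≥0 : ∀ i → NonNeg (- m i)
      -m≥0 i = nonNeg-resp (sym (-‿distribˡ-* (col i) p))
                           (nonNeg*nonNeg (offDiag≤0 (λ ())) (inj₁ 0<p))

      S : Matrix n
      S i j = A (suc i) (suc j) - m i * b j

      S-dominant : Dominant S
      S-dominant = record { offDiag≤0 = off ; rowSum>0 = row }
        where
        off : ∀ {i j} → i ≢ j → NonNeg (- S i j)
        off {i} {j} i≢j = nonNeg-resp eq
          (nonNeg+nonNeg (offDiag≤0 (λ si≡sj → i≢j (suc-injective si≡sj)))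
                         (nonNeg*nonNeg (-m≥0 i) (offDiag≤0 (λ ()))))
          where
          eq : - A (suc i) (suc j) + (- m i) * (- b j) ≈ - S i j
          eq = begin
            - A (suc i) (suc j) + (- m i) * (- b j)  ≈⟨ +-congˡ (-‿distribˡ-* (m i) (- b j)) ⟨
            - A (suc i) (suc j) - m i * (- b j)      ≈⟨ +-congˡ (-‿cong (-‿distribʳ-* (m i) (b j))) ⟨
            - A (suc i) (suc j) - - (m i * b j)      ≈⟨ -‿+-comm _ _ ⟩
            - S i j                                  ∎

        row : ∀ i → 0# < sum (S i)
        row i = <-respʳ-≈ (sym eq)
          (pos+nonNeg (rowSum>0 (suc i)) (nonNeg*nonNeg (-m≥0 i) (inj₁ (rowSum>0 zero))))
          where
          r : Carrier
          r = ∑[ j < n ] A (suc i) (suc j)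

          ma≈c : m i * a ≈ col i
          ma≈c = trans (*-assoc _ _ _) (trans (*-congˡ pa≈1) (*-identityʳ _))

          eq : sum (S i) ≈ (col i + r) + (- m i) * (a + sum b)
          eq = begin
            sum (S i)
              ≈⟨ ∑-distrib-+ _ (λ j → - (m i * b j)) ⟩
            r + ∑[ j < n ] (- (m i * b j))
              ≈⟨ +-congˡ (sum-neg (λ j → m i * b j)) ⟩
            r - ∑[ j < n ] (m i * b j)
              ≈⟨ +-congˡ (-‿cong (*-distribˡ-sum (m i) b)) ⟨
            r - m i * sum b
              ≈⟨ +-congʳ (x+y-y r (col i)) ⟨
            ((r + col i) - col i) - m i * sum b
              ≈⟨ +-assoc _ _ _ ⟩
            (r + col i) + (- col i - m i * sum b)
              ≈⟨ +-cong (+-comm r (col i)) (-‿+-comm _ _) ⟩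
            (col i + r) - (col i + m i * sum b)
              ≈⟨ +-congˡ (-‿cong (+-congʳ ma≈c)) ⟨
            (col i + r) - (m i * a + m i * sum b)
              ≈⟨ +-congˡ (-‿cong (distribˡ (m i) a (sum b))) ⟨
            (col i + r) - m i * (a + sum b)
              ≈⟨ +-congˡ (-‿distribˡ-* (m i) (a + sum b)) ⟩
            (col i + r) + (- m i) * (a + sum b)
              ∎

    Solution : ∀ {n} → Matrix n → Vector n → Set (c ⊔ ℓ₁)
    Solution {n} A v = Σ[ x ∈ Vector n ] (∀ i → ∑[ j < n ] (A i j * x j) ≈ v i)

    solve : ∀ {n} (A : Matrix n) → Dominant A → (v : Vector n) → Solution A v
    solve {zero}  A dom v = (λ ()) , λ ()
    solve {suc n} A dom v = x , Ax≈v
      where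
      open Eliminate A dom

      rec : Solution S (λ i → v (suc i) - m i * v zero)
      rec = solve S S-dominant _

      y : Vector n
      y = proj₁ rec

      t : Carrier
      t = ∑[ j < n ] (b j * y j)

      x : Vector (suc n)
      x zero    = p * (v zero - t)
      x (suc j) = y j

      Ax≈v : ∀ i → ∑[ j < suc n ] (A i j * x j) ≈ v i
      Ax≈v zero = begin
        a * (p * (v zero - t)) + t  ≈⟨ +-congʳ (*-assoc a p _) ⟨
        a * p * (v zero - t) + t    ≈⟨ +-congʳ (*-congʳ (trans (*-comm a p) pa≈1)) ⟩
        1# * (v zero - t) + t       ≈⟨ +-congʳ (*-identityˡ _) ⟩
        (v zero - t) + t            ≈⟨ x-y+y _ _ ⟩
        v zero                      ∎
      Ax≈v (suc i) = begin
        col i * (p * (v zero - t)) + ∑[ j < n ] (A (suc i) (suc j) * y j)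
          ≈⟨ +-cong (sym (*-assoc _ _ _)) rest ⟩
        m i * (v zero - t) + ((v (suc i) - m i * v zero) + m i * t)
          ≈⟨ +-comm _ _ ⟩
        ((v (suc i) - m i * v zero) + m i * t) + m i * (v zero - t)
          ≈⟨ +-assoc _ _ _ ⟩
        (v (suc i) - m i * v zero) + (m i * t + m i * (v zero - t))
          ≈⟨ +-congˡ (distribˡ (m i) t (v zero - t)) ⟨
        (v (suc i) - m i * v zero) + m i * (t + (v zero - t))
          ≈⟨ +-congˡ (*-congˡ (trans (+-comm _ _) (x-y+y _ _))) ⟩
        (v (suc i) - m i * v zero) + m i * v zero
          ≈⟨ x-y+y _ _ ⟩
        v (suc i)
          ∎
        where
        rest : ∑[ j < n ] (A (suc i) (suc j) * y j) ≈ (v (suc i) - m i * v zero) + m i * t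
        rest = begin
          ∑[ j < n ] (A (suc i) (suc j) * y j)
            ≈⟨ sum-cong-≋ (λ j → *-congʳ (x-y+y (A (suc i) (suc j)) (m i * b j))) ⟨
          ∑[ j < n ] ((S i j + m i * b j) * y j)
            ≈⟨ sum-cong-≋ (λ j → distribʳ (y j) (S i j) (m i * b j)) ⟩
          ∑[ j < n ] (S i j * y j + m i * b j * y j)
            ≈⟨ ∑-distrib-+ (λ j → S i j * y j) _ ⟩
          ∑[ j < n ] (S i j * y j) + ∑[ j < n ] (m i * b j * y j)
            ≈⟨ +-cong (proj₂ rec i) (sum-cong-≋ (λ j → *-assoc (m i) (b j) (y j))) ⟩
          (v (suc i) - m i * v zero) + ∑[ j < n ] (m i * (b j * y j))
            ≈⟨ +-congˡ (*-distribˡ-sum (m i) (λ j → b j * y j)) ⟨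
          (v (suc i) - m i * v zero) + m i * t
            ∎

    δ-sum : ∀ {n} (i : Fin n) (f : Vector n) →
            ∑[ j < n ] (if does (i ≟ j) then f j else 0#) ≈ f i
    δ-sum {suc n} zero    f = trans (+-congˡ (sum-zero n)) (+-identityʳ (f zero))
    δ-sum {suc n} (suc i) f = trans (+-identityˡ _) (δ-sum i (λ j → f (suc j)))

    𝟙-sym : ∀ {n} (i j : Fin n) → 𝟙 i j ≈ 𝟙 j i
    𝟙-sym i j with i ≟ j | j ≟ i
    ... | yes _   | yes _   = refl
    ... | no _    | no _    = refl
    ... | yes i≡j | no j≢i  = contradiction (≡.sym i≡j) j≢i
    ... | no i≢j  | yes j≡i = contradiction (≡.sym j≡i) i≢j

    dominant⇒invertible : ∀ {n} (A : Matrix n) → (∀ i j → A i j ≈ A j i) →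
                          Dominant A → Invertible A
    dominant⇒invertible {n} A A-sym dom = B , BA≈𝟙 , AB≈𝟙
      where
      B : Matrix n
      B i j = proj₁ (solve A dom (λ k → 𝟙 k j)) i

      AB≈𝟙 : A ⊗ B ≋ 𝟙
      AB≈𝟙 i j = proj₂ (solve A dom (λ k → 𝟙 k j)) i

      BᵀA≈𝟙 : ∀ i j → ∑[ k < n ] (B k i * A k j) ≈ 𝟙 i j
      BᵀA≈𝟙 i j = begin
        ∑[ k < n ] (B k i * A k j)  ≈⟨ sum-cong-≋ (λ k → trans (*-comm _ _) (*-congʳ (A-sym k j))) ⟩
        ∑[ k < n ] (A j k * B k i)  ≈⟨ AB≈𝟙 j i ⟩
        𝟙 j i                       ≈⟨ 𝟙-sym j i ⟩
        𝟙 i j                       ∎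

      pick : ∀ (i : Fin n) (f : Vector n) → ∑[ k < n ] (𝟙 i k * f k) ≈ f i
      pick i f = trans (sum-cong-≋ eq) (δ-sum i f)
        where
        eq : ∀ k → 𝟙 i k * f k ≈ (if does (i ≟ k) then f k else 0#)
        eq k with i ≟ k
        ... | yes _ = *-identityˡ (f k)
        ... | no _  = zeroˡ (f k)

      B-sym : ∀ i j → B i j ≈ B j i
      B-sym i j = begin
        B i j
          ≈⟨ pick i (λ k → B k j) ⟨
        ∑[ k < n ] (𝟙 i k * B k j)
          ≈⟨ sum-cong-≋ (λ k → *-congʳ (BᵀA≈𝟙 i k)) ⟨
        ∑[ k < n ] ((∑[ l < n ] (B l i * A l k)) * B k j)
          ≈⟨ sum-cong-≋ (λ k → *-distribʳ-sum (B k j) (λ l → B l i * A l k)) ⟩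
        ∑[ k < n ] ∑[ l < n ] (B l i * A l k * B k j)
          ≈⟨ ∑-comm (λ k l → B l i * A l k * B k j) ⟩
        ∑[ l < n ] ∑[ k < n ] (B l i * A l k * B k j)
          ≈⟨ sum-cong-≋ (λ l → sum-cong-≋ (λ k → *-assoc (B l i) (A l k) (B k j))) ⟩
        ∑[ l < n ] ∑[ k < n ] (B l i * (A l k * B k j))
          ≈⟨ sum-cong-≋ (λ l → *-distribˡ-sum (B l i) (λ k → A l k * B k j)) ⟨
        ∑[ l < n ] (B l i * (A ⊗ B) l j)
          ≈⟨ sum-cong-≋ (λ l → trans (*-congˡ (trans (AB≈𝟙 l j) (𝟙-sym l j))) (*-comm _ _)) ⟩
        ∑[ l < n ] (𝟙 j l * B l i)
          ≈⟨ pick j (λ l → B l i) ⟩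
        B j i
          ∎

      BA≈𝟙 : B ⊗ A ≋ 𝟙
      BA≈𝟙 i j = trans (sum-cong-≋ (λ k → *-congʳ (B-sym i k))) (BᵀA≈𝟙 i j)

    totalWeight-nonNeg : ∀ {n} (es : List (Edge n)) → NonNeg (totalWeight es)
    totalWeight-nonNeg []       = inj₂ refl
    totalWeight-nonNeg (e ∷ es) = inj₁ (pos+nonNeg (positive e) (totalWeight-nonNeg es))

    offDiagonal-sym : ∀ {n} (G : Multigraph n) i j → offDiagonal G i j ≡ offDiagonal G j i
    offDiagonal-sym G i j = ≡.cong (λ es → - totalWeight es)
      (filter-≐ (joins? i j) (joins? j i) (swap , swap) G)

    laplacian-sym : ∀ {n} (G : Multigraph n) i j → laplacian G i j ≈ laplacian G j i
    laplacian-sym G i j with i ≟ j | j ≟ i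
    ... | yes ≡.refl | yes _   = refl
    ... | no _       | no _    = reflexive (offDiagonal-sym G i j)
    ... | yes i≡j    | no j≢i  = contradiction (≡.sym i≡j) j≢i
    ... | no i≢j     | yes j≡i = contradiction (≡.sym j≡i) i≢j

    laplacian-rowSum : ∀ {n} (G : Multigraph n) i → sum (laplacian G i) ≈ 0#
    laplacian-rowSum {n} G i = begin
      sum (laplacian G i)                      ≈⟨ sum-cong-≋ split ⟩
      ∑[ j < n ] (diagonal j + off j)          ≈⟨ ∑-distrib-+ diagonal off ⟩
      sum diagonal + sum off                   ≈⟨ +-congʳ (δ-sum i (λ _ → - sum off)) ⟩
      - sum off + sum off                      ≈⟨ -‿inverseˡ (sum off) ⟩
      0#                                       ∎
      where
      off diagonal : Vector n
      off j = if does (i ≟ j) then 0# else offDiagonal G i j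
      diagonal j = if does (i ≟ j) then - sum off else 0#

      split : ∀ j → laplacian G i j ≈ diagonal j + off j
      split j with does (i ≟ j)
      ... | true  = sym (+-identityʳ _)
      ... | false = sym (+-identityˡ _)

    I+αL-dominant : ∀ {n} (G : Multigraph n) {α} → 0# < α → Dominant (𝟙 ⊕ α · laplacian G)
    I+αL-dominant {n} G {α} 0<α = record { offDiag≤0 = off ; rowSum>0 = row }
      where
      off : ∀ {i j} → i ≢ j → NonNeg (- (𝟙 ⊕ α · laplacian G) i j)
      off {i} {j} i≢j with i ≟ j
      ... | yes i≡j = contradiction i≡j i≢j
      ... | no _    = nonNeg-resp eq (nonNeg*nonNeg (inj₁ 0<α) (totalWeight-nonNeg es))
        where
        es : List (Edge n)
        es = filter (joins? i j) G

        eq : α * totalWeight es ≈ - (0# + α * - totalWeight es)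
        eq = begin
          α * totalWeight es           ≈⟨ -‿involutive _ ⟨
          - - (α * totalWeight es)     ≈⟨ -‿cong (-‿distribʳ-* α _) ⟩
          - (α * - totalWeight es)     ≈⟨ -‿cong (+-identityˡ _) ⟨
          - (0# + α * - totalWeight es)  ∎

      row : ∀ i → 0# < sum ((𝟙 ⊕ α · laplacian G) i)
      row i = <-respʳ-≈ (sym eq) 0<1
        where
        eq : sum ((𝟙 ⊕ α · laplacian G) i) ≈ 1#
        eq = begin
          ∑[ j < n ] (𝟙 i j + α * laplacian G i j)         ≈⟨ ∑-distrib-+ (𝟙 i) _ ⟩
          sum (𝟙 i) + ∑[ j < n ] (α * laplacian G i j)     ≈⟨ +-cong (δ-sum i (λ _ → 1#)) (sym (*-distribˡ-sum α (laplacian G i))) ⟩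
          1# + α * sum (laplacian G i)                     ≈⟨ +-congˡ (*-congˡ (laplacian-rowSum G i)) ⟩
          1# + α * 0#                                      ≈⟨ +-congˡ (zeroʳ α) ⟩
          1# + 0#                                          ≈⟨ +-identityʳ 1# ⟩
          1#                                               ∎

  open Inversion using (𝟙-sym; laplacian-sym; I+αL-dominant; dominant⇒invertible)

  abstract
    I+αL-invertible : ∀ {n} (G : Multigraph n) {α} → 0# < α → Invertible (𝟙 ⊕ α · laplacian G)
    I+αL-invertible G {α} 0<α =
      dominant⇒invertible _ (λ i j → +-cong (𝟙-sym i j) (*-congˡ (laplacian-sym G i j)))
                            (I+αL-dominant G 0<α)

  accessibility : ∀ {n} → Multigraph n → ∀ {α} → 0# < α → Matrix n
  accessibility G 0<α = proj₁ (I+αL-invertible G 0<α)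

  forestDistance : ∀ {n} → Multigraph n → ∀ {α} → 0# < α → Matrix n
  forestDistance G {α} 0<α i j = α * (q i i + q j j - q i j - q j i)
    where
    q = accessibility G 0<α

-- Passing from G to G′ replaces M = I + αL by M + αε u uᵀ with u = eₖ - eₜ.
-- With a = Qu and a′ = Q′u, the resolvent identity Q - Q′ = Q (M′ - M) Q′ then
-- reads q i j - q′ i j = αε a i a′ j.  Both inverses exist by diagonal dominance,
-- so 1 + ερ need not be shown nonzero by a positivity argument: the identity,
-- used twice, gives a′ = (1 - ερ′) a and (1 + ερ)(1 - ερ′) = 1.  Hence
-- ε (1 - ερ′) is the inverse of ρ + ε⁻¹, and substituting a′ gives the formula.
module Submission where

open import Defs
open import Algebra.Bundles using (CommutativeRing)
import Algebra.Apartness.Bundles as Apartness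
import Algebra.Properties.Ring as RingProperties
import Algebra.Properties.Semiring.Sum as SemiringSum
import Algebra.Solver.Ring.NaturalCoefficients.Default as SemiringSolver
open import Data.Bool.Base using (true; false; if_then_else_)
open import Data.Fin.Base using (Fin)
open import Data.Fin.Properties using (_≟_)
open import Data.List.Base using (_∷_; filter)
import Data.List.Relation.Binary.Permutation.Homogeneous as Permutation
open import Data.List.Relation.Binary.Pointwise.Base using ([]; _∷_)
open import Data.Product.Base using (_,_; Σ-syntax; proj₁; proj₂)
open import Data.Sum.Base using (inj₁; inj₂)
open import Function.Bundles using (mk⇔)
open import Relation.Binary.PropositionalEquality.Core as ≡ using (_≢_)
import Relation.Binary.Reasoning.Setoid as SetoidReasoning
open import Relation.Nullary.Decidable using (yes; no; does; does-⇔)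
open import Relation.Nullary.Negation using (contradiction)
open import Relation.Unary using (Pred; Decidable)

-- Sums and matrix algebra.

module MatrixLemmas {c ℓ₁ ℓ₂ ℓ₃} (K : OrderedField c ℓ₁ ℓ₂ ℓ₃) where

  open OrderedField K
  open Matrices K
  open Multigraphs.Inversion K using (δ-sum; 𝟙-sym; sum-neg)
  open CommutativeRing
    (Apartness.HeytingCommutativeRing.commutativeRing heytingCommutativeRing)
    using (commutativeSemiring)
  open RingProperties ring
    using (-‿distribʳ-*; x∙y⁻¹≈ε⇒x≈y; x≈y⇒x∙y⁻¹≈ε; [y-z]x≈yx-zx)
  open SemiringSum semiring
    using (sum; sum-syntax; sum-cong-≋; ∑-distrib-+; ∑-comm; *-distribˡ-sum; *-distribʳ-sum)
  open SemiringSolver commutativeSemiring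
    using (solve; _:=_; _:+_; _:*_)
  open SetoidReasoning setoid

  ∑-distrib-- : ∀ {n} (f g : Fin n → Carrier) → ∑[ i < n ] (f i - g i) ≈ sum f - sum g
  ∑-distrib-- f g = trans (∑-distrib-+ f (λ i → - g i)) (+-congˡ (sum-neg g))

  ∑-𝟙ˡ : ∀ {n} (i : Fin n) (f : Fin n → Carrier) → ∑[ j < n ] (𝟙 i j * f j) ≈ f i
  ∑-𝟙ˡ i f = trans (sum-cong-≋ select) (δ-sum i f)
    where
    select : ∀ j → 𝟙 i j * f j ≈ (if does (i ≟ j) then f j else 0#)
    select j with does (i ≟ j)
    ... | true  = *-identityˡ (f j)
    ... | false = zeroˡ (f j)

  ⊗-identityʳ : ∀ {n} (A : Matrix n) → A ⊗ 𝟙 ≋ A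
  ⊗-identityʳ A i j =
    trans (sum-cong-≋ (λ l → trans (*-congˡ (𝟙-sym l j)) (*-comm (A i l) (𝟙 j l))))
          (∑-𝟙ˡ j (A i))

  ⊗-assoc : ∀ {n} (A B C : Matrix n) → (A ⊗ B) ⊗ C ≋ A ⊗ (B ⊗ C)
  ⊗-assoc {n} A B C i j = begin
    ∑[ k < n ] ((∑[ l < n ] (A i l * B l k)) * C k j)
      ≈⟨ sum-cong-≋ (λ k → *-distribʳ-sum (C k j) (λ l → A i l * B l k)) ⟩
    ∑[ k < n ] ∑[ l < n ] (A i l * B l k * C k j)
      ≈⟨ ∑-comm (λ k l → A i l * B l k * C k j) ⟩
    ∑[ l < n ] ∑[ k < n ] (A i l * B l k * C k j)
      ≈⟨ sum-cong-≋ (λ l → sum-cong-≋ (λ k → *-assoc (A i l) (B l k) (C k j))) ⟩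
    ∑[ l < n ] ∑[ k < n ] (A i l * (B l k * C k j))
      ≈⟨ sum-cong-≋ (λ l → *-distribˡ-sum (A i l) (λ k → B l k * C k j)) ⟨
    ∑[ l < n ] (A i l * (B ⊗ C) l j)
      ∎

  -- In the difference of two row sums every off-diagonal term cancels, so only the difference of
  -- the diagonal entries is left. For Laplacians, whose rows sum to zero, this avoids unfolding the
  -- diagonal.
  ≋-from-rowSums : ∀ {n} {A B : Matrix n} → (∀ i j → i ≢ j → A i j ≈ B i j) →
                   (∀ i → sum (A i) ≈ sum (B i)) → A ≋ B
  ≋-from-rowSums {n} {A} {B} off rows i j with i ≟ j
  ... | no i≢j     = off i j i≢j
  ... | yes ≡.refl = x∙y⁻¹≈ε⇒x≈y _ _ (begin
    A i i - B i i
      ≈⟨ δ-sum i (λ _ → A i i - B i i) ⟨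
    ∑[ l < n ] (if does (i ≟ l) then A i i - B i i else 0#)
      ≈⟨ sum-cong-≋ difference ⟨
    ∑[ l < n ] (A i l - B i l)
      ≈⟨ ∑-distrib-- (A i) (B i) ⟩
    sum (A i) - sum (B i)
      ≈⟨ x≈y⇒x∙y⁻¹≈ε (rows i) ⟩
    0#
      ∎)
    where
    difference : ∀ l → A i l - B i l ≈ (if does (i ≟ l) then A i i - B i i else 0#)
    difference l with i ≟ l
    ... | yes ≡.refl = refl
    ... | no i≢l     = x≈y⇒x∙y⁻¹≈ε (off i l i≢l)

  -- The incidence vector `u` of a pair of vertices and its rank-one matrix.

  incidence : ∀ {n} → Fin n → Fin n → Fin n → Carrier
  incidence k t l = 𝟙 k l - 𝟙 t l

  ∑-incidence : ∀ {n} (k t : Fin n) (f : Fin n → Carrier) →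
                ∑[ l < n ] (incidence k t l * f l) ≈ f k - f t
  ∑-incidence {n} k t f = begin
    ∑[ l < n ] (incidence k t l * f l)
      ≈⟨ sum-cong-≋ (λ l → [y-z]x≈yx-zx (f l) (𝟙 k l) (𝟙 t l)) ⟩
    ∑[ l < n ] (𝟙 k l * f l - 𝟙 t l * f l)
      ≈⟨ ∑-distrib-- (λ l → 𝟙 k l * f l) (λ l → 𝟙 t l * f l) ⟩
    ∑[ l < n ] (𝟙 k l * f l) - ∑[ l < n ] (𝟙 t l * f l)
      ≈⟨ +-cong (∑-𝟙ˡ k f) (-‿cong (∑-𝟙ˡ t f)) ⟩
    f k - f t
      ∎

  -- The matrix `u uᵀ`; for distinct `k` and `t` it is the Laplacian of a single edge of unit weight
  -- between them.
  edgeLaplacian : ∀ {n} → Fin n → Fin n → Matrix n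
  edgeLaplacian k t i j = incidence k t i * incidence k t j

  edgeLaplacian-rowSum : ∀ {n} (k t i : Fin n) → sum (edgeLaplacian k t i) ≈ 0#
  edgeLaplacian-rowSum {n} k t i = begin
    ∑[ j < n ] (incidence k t i * incidence k t j)  ≈⟨ sum-cong-≋ (λ j → *-comm (incidence k t i) (incidence k t j)) ⟩
    -- The second factor does not depend on `j`, and `u` paired with a constant gives zero.
    ∑[ j < n ] (incidence k t j * incidence k t i)  ≈⟨ ∑-incidence k t (λ _ → incidence k t i) ⟩
    incidence k t i - incidence k t i               ≈⟨ -‿inverseʳ _ ⟩
    0#                                              ∎

  -- Inverse matrices and their rank-one perturbation.

  inverses-agree : ∀ {n} {A B C : Matrix n} → B ⊗ A ≋ 𝟙 → A ⊗ C ≋ 𝟙 → B ≋ C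
  inverses-agree {n} {A} {B} {C} BA≋𝟙 AC≋𝟙 i j = begin
    B i j              ≈⟨ ⊗-identityʳ B i j ⟨
    (B ⊗ 𝟙) i j        ≈⟨ sum-cong-≋ (λ l → *-congˡ (AC≋𝟙 l j)) ⟨
    (B ⊗ (A ⊗ C)) i j  ≈⟨ ⊗-assoc B A C i j ⟨
    ((B ⊗ A) ⊗ C) i j  ≈⟨ sum-cong-≋ (λ l → *-congʳ (BA≋𝟙 i l)) ⟩
    (𝟙 ⊗ C) i j        ≈⟨ ∑-𝟙ˡ i (λ l → C l j) ⟩
    C i j              ∎

  -- Transposing `A ⊗ B ≋ 𝟙` makes the transpose of `B` a left inverse of the symmetric matrix `A`,
  -- and a left inverse agrees with the right inverse `B`.
  inverse-sym : ∀ {n} {A B : Matrix n} → (∀ i j → A i j ≈ A j i) →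
                A ⊗ B ≋ 𝟙 → ∀ i j → B i j ≈ B j i
  inverse-sym {n} {A} {B} A-sym AB≋𝟙 i j = sym (inverses-agree BᵀA≋𝟙 AB≋𝟙 i j)
    where
    BᵀA≋𝟙 : (λ i j → B j i) ⊗ A ≋ 𝟙
    BᵀA≋𝟙 i j = begin
      ∑[ l < n ] (B l i * A l j)  ≈⟨ sum-cong-≋ (λ l → trans (*-comm _ _) (*-congʳ (A-sym l j))) ⟩
      ∑[ l < n ] (A j l * B l i)  ≈⟨ AB≋𝟙 j i ⟩
      𝟙 j i                       ≈⟨ 𝟙-sym j i ⟩
      𝟙 i j                       ∎

  -- The product `B A′ C` is evaluated in two ways. Since `A′ C` is the identity, it is `B`; since
  -- `B A′` is the identity plus `x (B u) uᵀ`, it is `C + x (B u) (uᵀ C)`.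
  rankOne-resolvent : ∀ {n} {A A′ B C : Matrix n} (x : Carrier) (k t : Fin n) →
                      A′ ≋ A ⊕ x · edgeLaplacian k t → B ⊗ A ≋ 𝟙 → A′ ⊗ C ≋ 𝟙 →
                      ∀ i j → B i j ≈ C i j + x * ((B i k - B i t) * (C k j - C t j))
  rankOne-resolvent {n} {A} {A′} {B} {C} x k t A′≋ BA≋𝟙 A′C≋𝟙 i j = begin
    B i j
      ≈⟨ ⊗-identityʳ B i j ⟨
    (B ⊗ 𝟙) i j
      ≈⟨ sum-cong-≋ (λ l → *-congˡ (A′C≋𝟙 l j)) ⟨
    (B ⊗ (A′ ⊗ C)) i j
      ≈⟨ ⊗-assoc B A′ C i j ⟨
    ∑[ l < n ] ((B ⊗ A′) i l * C l j)
      ≈⟨ sum-cong-≋ (λ l → *-congʳ (BA′ l)) ⟩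
    ∑[ l < n ] ((𝟙 i l + u l * (x * b)) * C l j)
      ≈⟨ sum-cong-≋ (λ l → solve 4 (λ d v y z → (d :+ v :* y) :* z := d :* z :+ v :* (y :* z))
                                   refl (𝟙 i l) (u l) (x * b) (C l j)) ⟩
    ∑[ l < n ] (𝟙 i l * C l j + u l * (x * b * C l j))
      ≈⟨ ∑-distrib-+ (λ l → 𝟙 i l * C l j) _ ⟩
    ∑[ l < n ] (𝟙 i l * C l j) + ∑[ l < n ] (u l * (x * b * C l j))
      ≈⟨ +-cong (∑-𝟙ˡ i (λ l → C l j)) (∑-incidence k t (λ l → x * b * C l j)) ⟩
    C i j + (x * b * C k j - x * b * C t j)
      -- The sign moves inward so that `- C t j` can enter the semiring solver as an atom.
      ≈⟨ +-congˡ (+-congˡ (-‿distribʳ-* (x * b) (C t j))) ⟩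
    C i j + (x * b * C k j + x * b * - C t j)
      ≈⟨ solve 5 (λ d v y z w → d :+ (v :* y :* z :+ v :* y :* w) := d :+ v :* (y :* (z :+ w)))
                 refl (C i j) x b (C k j) (- C t j) ⟩
    C i j + x * (b * (C k j - C t j))
      ∎
    where
    u = incidence k t
    b = B i k - B i t

    BA′ : ∀ l → (B ⊗ A′) i l ≈ 𝟙 i l + u l * (x * b)
    BA′ l = begin
      ∑[ m < n ] (B i m * A′ m l)
        ≈⟨ sum-cong-≋ (λ m → *-congˡ (A′≋ m l)) ⟩
      ∑[ m < n ] (B i m * (A m l + x * (u m * u l)))
        ≈⟨ sum-cong-≋ (λ m → solve 5 (λ d v y z w → d :* (v :+ y :* (z :* w))
                                                      := d :* v :+ z :* (w :* y :* d))
                                     refl (B i m) (A m l) x (u m) (u l)) ⟩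
      ∑[ m < n ] (B i m * A m l + u m * (u l * x * B i m))
        ≈⟨ ∑-distrib-+ (λ m → B i m * A m l) _ ⟩
      (B ⊗ A) i l + ∑[ m < n ] (u m * (u l * x * B i m))
        ≈⟨ +-cong (BA≋𝟙 i l) (∑-incidence k t (λ m → u l * x * B i m)) ⟩
      𝟙 i l + (u l * x * B i k - u l * x * B i t)
        ≈⟨ +-congˡ (+-congˡ (-‿distribʳ-* (u l * x) (B i t))) ⟩
      𝟙 i l + (u l * x * B i k + u l * x * - B i t)
        ≈⟨ solve 5 (λ d v y z w → d :+ (v :* y :* z :+ v :* y :* w) := d :+ v :* (y :* (z :+ w)))
                   refl (𝟙 i l) (u l) x (B i k) (- B i t) ⟩
      𝟙 i l + u l * (x * b)
        ∎

-- Weights between two vertices as sums of contributions of single edges.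

module LaplacianUpdate {c ℓ₁ ℓ₂ ℓ₃} (K : OrderedField c ℓ₁ ℓ₂ ℓ₃) where

  open OrderedField K
  open Matrices K
  open Multigraphs K
  open Inversion using (laplacian-rowSum; x-y+y)
  open MatrixLemmas K
  open CommutativeRing
    (Apartness.HeytingCommutativeRing.commutativeRing heytingCommutativeRing)
    using (commutativeSemiring)
  open RingProperties ring
    using (-‿distribˡ-*; -‿distribʳ-*; -‿involutive; -0#≈0#; -‿+-comm; -1*x≈-x; ⁻¹-anti-homo‿-)
  open SemiringSum semiring
    using (sum; ∑-distrib-+; *-distribˡ-sum)
  open SemiringSolver commutativeSemiring
    using (solve; _:=_; _:+_; _:*_)
  open SetoidReasoning setoid

  weightIf : ∀ {n p} {P : Pred (Edge n) p} → Decidable P → Edge n → Carrier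
  weightIf P? e = if does (P? e) then weight e else 0#

  totalWeight-filter-∷ : ∀ {n p} {P : Pred (Edge n) p} (P? : Decidable P) e es →
    totalWeight (filter P? (e ∷ es)) ≈ weightIf P? e + totalWeight (filter P? es)
  totalWeight-filter-∷ P? e es with does (P? e)
  ... | true  = refl
  ... | false = sym (+-identityˡ _)

  Joins-trans : ∀ {n} {e f : Edge n} {i j} →
                Joins e (src f) (tgt f) → Joins f i j → Joins e i j
  Joins-trans e-f            (inj₁ (≡.refl , ≡.refl)) = e-f
  Joins-trans (inj₁ (p , q)) (inj₂ (≡.refl , ≡.refl)) = inj₂ (p , q)
  Joins-trans (inj₂ (p , q)) (inj₂ (≡.refl , ≡.refl)) = inj₁ (p , q)

  Joins-sym : ∀ {n} {e f : Edge n} → Joins e (src f) (tgt f) → Joins f (src e) (tgt e)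
  Joins-sym (inj₁ (p , q)) = inj₁ (≡.sym p , ≡.sym q)
  Joins-sym (inj₂ (p , q)) = inj₂ (≡.sym q , ≡.sym p)

  -- Edges equal up to orientation join the same pairs, so both tests return the same boolean;
  -- matching on that equality removes the two mixed cases.
  weightIf-joins-cong : ∀ {n} (e f : Edge n) i j → e ≈ᴱ f →
                        weightIf (joins? i j) e ≈ weightIf (joins? i j) f
  weightIf-joins-cong e f i j (e-f , w≈)
    with does (joins? i j e) | does (joins? i j f)
       | does-⇔ (mk⇔ (Joins-trans {e = f} {e} (Joins-sym {e = e} {f} e-f))
                     (Joins-trans {e = e} {f} e-f)) (joins? i j e) (joins? i j f)
  ... | true  | true  | _ = w≈
  ... | false | false | _ = refl

  -- By induction on the permutation: each edge contributes its own summand, so commutativity of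
  -- addition absorbs every reordering.
  weightBetween-cong : ∀ {n} {G H : Multigraph n} i j → G ≈ᴳ H →
    totalWeight (filter (joins? i j) G) ≈ totalWeight (filter (joins? i j) H)
  weightBetween-cong i j (Permutation.refl []) = refl
  weightBetween-cong {G = e ∷ es} {f ∷ fs} i j (Permutation.refl (e≈f ∷ es≈fs)) = begin
    totalWeight (filter (joins? i j) (e ∷ es))
      ≈⟨ totalWeight-filter-∷ (joins? i j) e es ⟩
    weightIf (joins? i j) e + totalWeight (filter (joins? i j) es)
      ≈⟨ +-cong (weightIf-joins-cong e f i j e≈f) (weightBetween-cong i j (Permutation.refl es≈fs)) ⟩
    weightIf (joins? i j) f + totalWeight (filter (joins? i j) fs)
      ≈⟨ totalWeight-filter-∷ (joins? i j) f fs ⟨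
    totalWeight (filter (joins? i j) (f ∷ fs))
      ∎
  weightBetween-cong i j (Permutation.prep {xs = es} {fs} {e} {f} e≈f es≈fs) = begin
    totalWeight (filter (joins? i j) (e ∷ es))
      ≈⟨ totalWeight-filter-∷ (joins? i j) e es ⟩
    weightIf (joins? i j) e + totalWeight (filter (joins? i j) es)
      ≈⟨ +-cong (weightIf-joins-cong e f i j e≈f) (weightBetween-cong i j es≈fs) ⟩
    weightIf (joins? i j) f + totalWeight (filter (joins? i j) fs)
      ≈⟨ totalWeight-filter-∷ (joins? i j) f fs ⟨
    totalWeight (filter (joins? i j) (f ∷ fs))
      ∎
  weightBetween-cong i j (Permutation.swap {xs = es} {fs} {e₁} {e₂} {f₁} {f₂} e₁≈f₁ e₂≈f₂ es≈fs) = begin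
    totalWeight (filter (joins? i j) (e₁ ∷ e₂ ∷ es))
      ≈⟨ trans (totalWeight-filter-∷ (joins? i j) e₁ (e₂ ∷ es))
               (+-congˡ (totalWeight-filter-∷ (joins? i j) e₂ es)) ⟩
    weightIf (joins? i j) e₁ + (weightIf (joins? i j) e₂ + totalWeight (filter (joins? i j) es))
      ≈⟨ solve 3 (λ x y z → x :+ (y :+ z) := y :+ (x :+ z)) refl _ _ _ ⟩
    weightIf (joins? i j) e₂ + (weightIf (joins? i j) e₁ + totalWeight (filter (joins? i j) es))
      ≈⟨ +-cong (weightIf-joins-cong e₂ f₂ i j e₂≈f₂)
                (+-cong (weightIf-joins-cong e₁ f₁ i j e₁≈f₁) (weightBetween-cong i j es≈fs)) ⟩
    weightIf (joins? i j) f₂ + (weightIf (joins? i j) f₁ + totalWeight (filter (joins? i j) fs))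
      ≈⟨ trans (totalWeight-filter-∷ (joins? i j) f₂ (f₁ ∷ fs))
               (+-congˡ (totalWeight-filter-∷ (joins? i j) f₁ fs)) ⟨
    totalWeight (filter (joins? i j) (f₂ ∷ f₁ ∷ fs))
      ∎
  weightBetween-cong i j (Permutation.trans G≈H H≈I) =
    trans (weightBetween-cong i j G≈H) (weightBetween-cong i j H≈I)

  -- The change of the Laplacian caused by one edge.

  edgeLaplacian-swap : ∀ {n} (k t : Fin n) → edgeLaplacian k t ≋ edgeLaplacian t k
  edgeLaplacian-swap k t i j = begin
    incidence k t i * incidence k t j
      ≈⟨ *-cong (⁻¹-anti-homo‿- (𝟙 t i) (𝟙 k i)) (⁻¹-anti-homo‿- (𝟙 t j) (𝟙 k j)) ⟨
    - incidence t k i * - incidence t k j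
      ≈⟨ -‿distribˡ-* _ _ ⟨
    - (incidence t k i * - incidence t k j)
      ≈⟨ -‿cong (-‿distribʳ-* _ _) ⟨
    - - (incidence t k i * incidence t k j)
      ≈⟨ -‿involutive _ ⟩
    incidence t k i * incidence t k j
      ∎

  -- Off the diagonal, `u uᵀ` is -1 at the two positions formed by the ends of the edge and 0
  -- elsewhere.
  weightIf-joins : ∀ {n} (e : Edge n) {i j} → i ≢ j →
                   - weightIf (joins? i j) e ≈ weight e * edgeLaplacian (src e) (tgt e) i j
  weightIf-joins e {i} {j} i≢j = cases
    where
    w = weight e

    hit : ∀ {x y} → x * y ≈ - 1# → - w ≈ w * (x * y)
    hit {x} {y} xy≈-1 = begin
      - w          ≈⟨ -1*x≈-x w ⟨
      - 1# * w     ≈⟨ *-comm (- 1#) w ⟩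
      w * - 1#     ≈⟨ *-congˡ xy≈-1 ⟨
      w * (x * y)  ∎

    miss : ∀ {x y} → x * y ≈ 0# → - 0# ≈ w * (x * y)
    miss {x} {y} xy≈0 = begin
      - 0#         ≈⟨ -0#≈0# ⟩
      0#           ≈⟨ zeroʳ w ⟨
      w * 0#       ≈⟨ *-congˡ xy≈0 ⟨
      w * (x * y)  ∎

    missˡ : ∀ y → - 0# ≈ w * ((0# - 0#) * y)
    missˡ y = miss (trans (*-congʳ (x-0≈x 0#)) (zeroˡ y))

    missʳ : ∀ x → - 0# ≈ w * (x * (0# - 0#))
    missʳ x = miss (trans (*-congˡ (x-0≈x 0#)) (zeroʳ x))

    [1-0][0-1]≈-1 : (1# - 0#) * (0# - 1#) ≈ - 1#
    [1-0][0-1]≈-1 = trans (*-cong (x-0≈x 1#) (+-identityˡ (- 1#))) (*-identityˡ (- 1#))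

    cases : - weightIf (joins? i j) e ≈ w * edgeLaplacian (src e) (tgt e) i j
    -- The first four clauses are refuted by `i ≢ j` or by the absence of loops. The next two are
    -- the two orientations of a joining edge. In the others at most one end matches, and one factor
    -- of the entry is `0# - 0#`.
    cases with src e ≟ i | tgt e ≟ j | src e ≟ j | tgt e ≟ i
    ... | yes p | _     | yes q | _     = contradiction (≡.trans (≡.sym p) q) i≢j
    ... | yes p | _     | _     | yes q = contradiction (≡.trans p (≡.sym q)) (loopless e)
    ... | _     | yes p | yes q | _     = contradiction (≡.trans q (≡.sym p)) (loopless e)
    ... | _     | yes p | _     | yes q = contradiction (≡.trans (≡.sym q) p) i≢j
    ... | yes _ | yes _ | no _  | no _  = hit [1-0][0-1]≈-1
    ... | no _  | no _  | yes _ | yes _ = hit (trans (*-comm _ _) [1-0][0-1]≈-1)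
    ... | yes _ | no _  | no _  | no _  = missʳ _
    ... | no _  | yes _ | no _  | no _  = missˡ _
    ... | no _  | no _  | yes _ | no _  = missˡ _
    ... | no _  | no _  | no _  | yes _ = missʳ _
    ... | no _  | no _  | no _  | no _  = missʳ _

  -- The stored order of the ends may be the reverse of `k`, `t`; this is harmless because reversal
  -- negates `u` and so fixes `u uᵀ`.
  offDiagonal-∷ : ∀ {n} {k t : Fin n} {e} → Joins e k t → ∀ G {i j} → i ≢ j →
                  offDiagonal (e ∷ G) i j ≈ offDiagonal G i j + weight e * edgeLaplacian k t i j
  offDiagonal-∷ {k = k} {t} {e} e-kt G {i} {j} i≢j = begin
    - totalWeight (filter (joins? i j) (e ∷ G))
      ≈⟨ -‿cong (totalWeight-filter-∷ (joins? i j) e G) ⟩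
    - (weightIf (joins? i j) e + totalWeight (filter (joins? i j) G))
      ≈⟨ -‿+-comm _ _ ⟨
    - weightIf (joins? i j) e + offDiagonal G i j
      ≈⟨ +-comm _ _ ⟩
    offDiagonal G i j - weightIf (joins? i j) e
      ≈⟨ +-congˡ (trans (weightIf-joins e i≢j) (*-congˡ (orient e-kt))) ⟩
    offDiagonal G i j + weight e * edgeLaplacian k t i j
      ∎
    where
    orient : Joins e k t → edgeLaplacian (src e) (tgt e) i j ≈ edgeLaplacian k t i j
    orient (inj₁ (≡.refl , ≡.refl)) = refl
    orient (inj₂ (≡.refl , ≡.refl)) = edgeLaplacian-swap t k i j

  offDiagonal-cong : ∀ {n} {G H : Multigraph n} → G ≈ᴳ H → offDiagonal G ≋ offDiagonal H
  offDiagonal-cong G≈H i j = -‿cong (weightBetween-cong i j G≈H)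

  -- All three kinds of change reduce to an edge in front of a list: reweighting compares two edges
  -- over a common `rest`, and removal is addition read backwards.
  offDiagonal-update : ∀ {n} {k t : Fin n} {ε G G′} → DiffersInEdge k t ε G G′ → ∀ {i j} → i ≢ j →
                       offDiagonal G′ i j ≈ offDiagonal G i j + ε * edgeLaplacian k t i j
  offDiagonal-update {k = k} {t} {ε} {G} {G′}
                     (reweight {e} {e′} {rest} e-kt e′-kt w′≈w+ε G≈ G′≈) {i} {j} i≢j = begin
    offDiagonal G′ i j
      ≈⟨ trans (offDiagonal-cong G′≈ i j) (offDiagonal-∷ e′-kt rest i≢j) ⟩
    offDiagonal rest i j + weight e′ * x
      ≈⟨ +-congˡ (*-congʳ w′≈w+ε) ⟩
    offDiagonal rest i j + (weight e + ε) * x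
      ≈⟨ solve 4 (λ a b c d → a :+ (b :+ c) :* d := (a :+ b :* d) :+ c :* d)
                 refl (offDiagonal rest i j) (weight e) ε x ⟩
    offDiagonal rest i j + weight e * x + ε * x
      ≈⟨ +-congʳ (trans (offDiagonal-cong G≈ i j) (offDiagonal-∷ e-kt rest i≢j)) ⟨
    offDiagonal G i j + ε * x
      ∎
    where x = edgeLaplacian k t i j
  offDiagonal-update {k = k} {t} {ε} {G} {G′} (add {e} _ e-kt w≈ε G′≈) {i} {j} i≢j = begin
    offDiagonal G′ i j                ≈⟨ offDiagonal-cong G′≈ i j ⟩
    offDiagonal (e ∷ G) i j           ≈⟨ offDiagonal-∷ e-kt G i≢j ⟩
    offDiagonal G i j + weight e * x  ≈⟨ +-congˡ (*-congʳ w≈ε) ⟩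
    offDiagonal G i j + ε * x         ∎
    where x = edgeLaplacian k t i j
  offDiagonal-update {k = k} {t} {ε} {G} {G′} (remove {e} _ e-kt w≈-ε G≈) {i} {j} i≢j = begin
    offDiagonal G′ i j
      -- Here `G` is `G′` with an extra edge of weight `- ε`, so `- ε * x` is split off to rebuild
      -- the entry of `G`.
      ≈⟨ x-y+y _ (ε * x) ⟨
    offDiagonal G′ i j - ε * x + ε * x
      ≈⟨ +-congʳ (+-congˡ (trans (-‿distribˡ-* ε x) (*-congʳ (sym w≈-ε)))) ⟩
    offDiagonal G′ i j + weight e * x + ε * x
      ≈⟨ +-congʳ (trans (offDiagonal-cong G≈ i j) (offDiagonal-∷ e-kt G′ i≢j)) ⟨
    offDiagonal G i j + ε * x
      ∎
    where x = edgeLaplacian k t i j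

  laplacian-offDiagonal : ∀ {n} (G : Multigraph n) {i j} → i ≢ j →
                          laplacian G i j ≈ offDiagonal G i j
  laplacian-offDiagonal G {i} {j} i≢j with i ≟ j
  ... | yes i≡j = contradiction i≡j i≢j
  ... | no _    = refl

  -- The off-diagonal entries are settled by `offDiagonal-update`, and the diagonal follows because
  -- all rows on both sides sum to zero.
  laplacian-update : ∀ {n} {k t : Fin n} {ε G G′} → DiffersInEdge k t ε G G′ →
                     laplacian G′ ≋ laplacian G ⊕ ε · edgeLaplacian k t
  laplacian-update {n} {k} {t} {ε} {G} {G′} diff = ≋-from-rowSums off rows
    where
    off : ∀ i j → i ≢ j → laplacian G′ i j ≈ laplacian G i j + ε * edgeLaplacian k t i j
    off i j i≢j = begin
      laplacian G′ i j                                ≈⟨ laplacian-offDiagonal G′ i≢j ⟩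
      offDiagonal G′ i j                              ≈⟨ offDiagonal-update diff i≢j ⟩
      offDiagonal G i j + ε * edgeLaplacian k t i j   ≈⟨ +-congʳ (laplacian-offDiagonal G i≢j) ⟨
      laplacian G i j + ε * edgeLaplacian k t i j     ∎

    rows : ∀ i → sum (laplacian G′ i) ≈ sum ((laplacian G ⊕ ε · edgeLaplacian k t) i)
    rows i = begin
      sum (laplacian G′ i)
        ≈⟨ laplacian-rowSum G′ i ⟩
      0#
        ≈⟨ zeroʳ ε ⟨
      ε * 0#
        ≈⟨ *-congˡ (edgeLaplacian-rowSum k t i) ⟨
      ε * sum (edgeLaplacian k t i)
        ≈⟨ *-distribˡ-sum ε (edgeLaplacian k t i) ⟩
      sum ((ε · edgeLaplacian k t) i)
        ≈⟨ +-identityˡ _ ⟨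
      0# + sum ((ε · edgeLaplacian k t) i)
        ≈⟨ +-congʳ (laplacian-rowSum G i) ⟨
      sum (laplacian G i) + sum ((ε · edgeLaplacian k t) i)
        ≈⟨ ∑-distrib-+ (laplacian G i) _ ⟨
      sum ((laplacian G ⊕ ε · edgeLaplacian k t) i)
        ∎

-- Reciprocals, and symmetry of the accessibility matrix.

module AccessibilityUpdate {c ℓ₁ ℓ₂ ℓ₃} (K : OrderedField c ℓ₁ ℓ₂ ℓ₃) where

  open OrderedField K
  open Matrices K
  open Multigraphs K
  open Inversion using (𝟙-sym; laplacian-sym; x+y-y)
  open MatrixLemmas K
  open LaplacianUpdate K
  open CommutativeRing
    (Apartness.HeytingCommutativeRing.commutativeRing heytingCommutativeRing)
    using (commutativeSemiring)
  open RingProperties ring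
    using (-‿distribˡ-*; -‿distribʳ-*; -‿+-comm; ⁻¹-anti-homo‿-)
  open SemiringSolver commutativeSemiring
    using (solve; con; _:=_; _:+_; _:*_)
  open SetoidReasoning setoid

  recip-unique : ∀ {x y} (x#0 : x # 0#) → x * y ≈ 1# → recip x x#0 ≈ y
  recip-unique {x} {y} x#0 xy≈1 = begin
    recip x x#0            ≈⟨ *-identityʳ _ ⟨
    recip x x#0 * 1#       ≈⟨ *-congˡ xy≈1 ⟨
    recip x x#0 * (x * y)  ≈⟨ *-assoc _ _ _ ⟨
    recip x x#0 * x * y    ≈⟨ *-congʳ (recip-inverseˡ x#0) ⟩
    1# * y                 ≈⟨ *-identityˡ y ⟩
    y                      ∎

  -- Serves to show the denominator of the formula nonzero by exhibiting its inverse.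
  inverse⇒#0 : ∀ {x y} → x * y ≈ 1# → x # 0#
  inverse⇒#0 {x} {y} xy≈1 =
    invertible⇒# (y , trans (*-congˡ (x-0≈x x)) (trans (*-comm y x) xy≈1)
                    , trans (*-congʳ (x-0≈x x)) xy≈1)

  I+αL-sym : ∀ {n} (G : Multigraph n) α i j →
             (𝟙 ⊕ α · laplacian G) i j ≈ (𝟙 ⊕ α · laplacian G) j i
  I+αL-sym G α i j = +-cong (𝟙-sym i j) (*-congˡ (laplacian-sym G i j))

  accessibility-sym : ∀ {n} (G : Multigraph n) {α} (0<α : 0# < α) i j →
                      accessibility G 0<α i j ≈ accessibility G 0<α j i
  accessibility-sym G {α} 0<α =
    inverse-sym (I+αL-sym G α) (proj₂ (proj₂ (I+αL-invertible G 0<α)))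

  -- The right side is `α (uᵀ Q u)`, the form in which the resolvent identity meets the distance.
  forestDistance-difference : ∀ {n} (G : Multigraph n) {α} (0<α : 0# < α) k t →
    let q = accessibility G 0<α
    in forestDistance G 0<α k t ≈ α * ((q k k - q k t) - (q t k - q t t))
  forestDistance-difference G {α} 0<α k t = *-congˡ (begin
    q k k + q t t - q k t - q t k
      ≈⟨ solve 4 (λ x y z w → x :+ y :+ z :+ w := x :+ z :+ (y :+ w)) refl _ _ _ _ ⟩
    q k k - q k t + (q t t - q t k)
      ≈⟨ +-congˡ (⁻¹-anti-homo‿- (q t k) (q t t)) ⟨
    q k k - q k t - (q t k - q t t)
      ∎)
    where q = accessibility G 0<α

  -- Pairs a perturbation identity with `u`: applied once it leads from `q` to `a`, applied again
  -- from `a` to `b`.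
  subtract-perturbed : ∀ {x₁ x₂ y₁ y₂ z₁ z₂} s → x₁ ≈ y₁ + s * z₁ → x₂ ≈ y₂ + s * z₂ →
                       x₁ - x₂ ≈ (y₁ - y₂) + s * (z₁ - z₂)
  subtract-perturbed {x₁} {x₂} {y₁} {y₂} {z₁} {z₂} s eq₁ eq₂ = begin
    x₁ - x₂
      ≈⟨ +-cong eq₁ (-‿cong eq₂) ⟩
    y₁ + s * z₁ - (y₂ + s * z₂)
      ≈⟨ +-congˡ (-‿+-comm y₂ (s * z₂)) ⟨
    y₁ + s * z₁ + (- y₂ - s * z₂)
      ≈⟨ +-congˡ (+-congˡ (-‿distribʳ-* s z₂)) ⟩
    y₁ + s * z₁ + (- y₂ + s * - z₂)
      ≈⟨ solve 5 (λ a b c d e → a :+ e :* b :+ (c :+ e :* d) := a :+ c :+ e :* (b :+ d))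
                 refl y₁ z₁ (- y₂) (- z₂) s ⟩
    (y₁ - y₂) + s * (z₁ - z₂)
      ∎

  -- The update formula for a fixed pair of multigraphs.

  module _ {n} (G G′ : Multigraph n) {α} (0<α : 0# < α) (k t : Fin n)
           (ε : Carrier) (ε#0 : ε # 0#) (diff : DiffersInEdge k t ε G G′) where

    q q′ : Matrix n
    q  = accessibility G 0<α
    q′ = accessibility G′ 0<α

    s : Carrier
    s = α * ε

    a a′ : Fin n → Carrier
    a  i = q i k - q i t
    a′ i = q′ i k - q′ i t

    -- These are `uᵀ Q u` and `uᵀ Q′ u`; times `α` they are the forest distances between `k` and `t`
    -- in `G` and `G′`.
    b b′ : Carrier
    b  = a k - a t
    b′ = a′ k - a′ t

    I+αL-update : 𝟙 ⊕ α · laplacian G′ ≋ (𝟙 ⊕ α · laplacian G) ⊕ s · edgeLaplacian k t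
    I+αL-update i j = begin
      𝟙 i j + α * laplacian G′ i j
        ≈⟨ +-congˡ (*-congˡ (laplacian-update diff i j)) ⟩
      𝟙 i j + α * (laplacian G i j + ε * edgeLaplacian k t i j)
        ≈⟨ solve 5 (λ d x l e w → d :+ x :* (l :+ e :* w) := d :+ x :* l :+ x :* e :* w)
                   refl (𝟙 i j) α (laplacian G i j) ε (edgeLaplacian k t i j) ⟩
      𝟙 i j + α * laplacian G i j + s * edgeLaplacian k t i j
        ∎

    resolvent : ∀ i j → q i j ≈ q′ i j + s * (a i * a′ j)
    resolvent i j = trans
      (rankOne-resolvent s k t I+αL-update
        (proj₁ (proj₂ (I+αL-invertible G 0<α))) (proj₂ (proj₂ (I+αL-invertible G′ 0<α))) i j)
      -- Symmetry of `q′` turns the difference of rows `k` and `t` into the difference of columns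
      -- `a′ j`.
      (+-congˡ (*-congˡ (*-congˡ
        (+-cong (accessibility-sym G′ 0<α k j) (-‿cong (accessibility-sym G′ 0<α t j))))))

    factor-- : ∀ x y z → x * y - x * z ≈ x * (y - z)
    factor-- x y z = trans (+-congˡ (-‿distribʳ-* x z)) (sym (distribˡ x y (- z)))

    a-resolvent : ∀ i → a i ≈ a′ i + s * (a i * b′)
    a-resolvent i = trans (subtract-perturbed s (resolvent i k) (resolvent i t))
                          (+-congˡ (*-congˡ (factor-- (a i) (a′ k) (a′ t))))

    b-resolvent : b ≈ b′ + s * (b * b′)
    b-resolvent = trans (subtract-perturbed s (a-resolvent k) (a-resolvent t))
                        (+-congˡ (*-congˡ (trans (+-congˡ (-‿distribˡ-* (a t) b′))
                                                 (sym (distribʳ b′ (a k) (- a t))))))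

    -- As `α * b′` is the distance `ρ′` in `G′`, this is `1 - ερ′`.
    r : Carrier
    r = 1# - s * b′

    a′≈ar : ∀ i → a′ i ≈ a i * r
    a′≈ar i = begin
      a′ i
        ≈⟨ x+y-y (a′ i) (s * (a i * b′)) ⟨
      a′ i + s * (a i * b′) - s * (a i * b′)
        ≈⟨ +-congʳ (a-resolvent i) ⟨
      a i - s * (a i * b′)
        ≈⟨ +-congˡ (-‿cong (solve 3 (λ x y z → x :* (y :* z) := y :* (x :* z)) refl s (a i) b′)) ⟩
      a i - a i * (s * b′)
        ≈⟨ +-congʳ (*-identityʳ (a i)) ⟨
      a i * 1# - a i * (s * b′)
        ≈⟨ factor-- (a i) 1# (s * b′) ⟩
      a i * r
        ∎

    -- Expanding, the subtracted terms collect to `s * (b′ + s * (b * b′))`, which is `s * b` by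
    -- `b-resolvent`.
    [1+sb]r≈1 : (1# + s * b) * r ≈ 1#
    [1+sb]r≈1 = begin
      (1# + s * b) * r
        ≈⟨ factor-- (1# + s * b) 1# (s * b′) ⟨
      (1# + s * b) * 1# - (1# + s * b) * (s * b′)
        ≈⟨ +-cong (*-identityʳ _) (-‿cong
             (solve 3 (λ x y z → (con 1 :+ x :* y) :* (x :* z) := x :* (z :+ x :* (y :* z)))
                      refl s b b′)) ⟩
      1# + s * b - s * (b′ + s * (b * b′))
        ≈⟨ +-congˡ (-‿cong (*-congˡ b-resolvent)) ⟨
      1# + s * b - s * b
        ≈⟨ x+y-y 1# (s * b) ⟩
      1#
        ∎

    d : Carrier
    d = forestDistance G 0<α k t + recip ε ε#0

    -- The factor `ε` turns `ρ + ε⁻¹` into `1# + s * b`, whose inverse is `r`.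
    d-inverse : d * (ε * r) ≈ 1#
    d-inverse = begin
      d * (ε * r)
        ≈⟨ *-congʳ (+-congʳ (forestDistance-difference G 0<α k t)) ⟩
      (α * (q k k - q k t - (q t k - q t t)) + recip ε ε#0) * (ε * r)
        ≈⟨ solve 5 (λ x y z e w → (x :* y :+ z) :* (e :* w) := (z :* e :+ x :* e :* y) :* w)
                   refl α b (recip ε ε#0) ε r ⟩
      (recip ε ε#0 * ε + s * b) * r
        ≈⟨ *-congʳ (+-congʳ (recip-inverseˡ ε#0)) ⟩
      (1# + s * b) * r
        ≈⟨ [1+sb]r≈1 ⟩
      1#
        ∎

    d#0 : d # 0#
    d#0 = inverse⇒#0 d-inverse

    -- In the resolvent identity `a′ j` becomes `a j * r`, and `ε * r` is the reciprocal of `d`. The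
    -- overall minus sign reverses `q j k - q j t`.
    accessibility-update : ∀ i j →
      q′ i j - q i j ≈ α * ((q i k - q i t) * (q j t - q j k)) * recip d d#0
    accessibility-update i j = begin
      q′ i j - q i j
        ≈⟨ ⁻¹-anti-homo‿- (q i j) (q′ i j) ⟨
      - (q i j - q′ i j)
        ≈⟨ -‿cong (trans (+-congʳ (trans (resolvent i j) (+-comm _ _))) (x+y-y _ (q′ i j))) ⟩
      - (s * (a i * a′ j))
        ≈⟨ -‿cong (*-congˡ (*-congˡ (a′≈ar j))) ⟩
      - (s * (a i * (a j * r)))
        ≈⟨ -‿cong (solve 5 (λ x e y z w → x :* e :* (y :* (z :* w)) := x :* y :* (e :* w) :* z)
                           refl α ε (a i) (a j) r) ⟩
      - (α * a i * (ε * r) * a j)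
        ≈⟨ -‿distribʳ-* _ (a j) ⟩
      α * a i * (ε * r) * - a j
        ≈⟨ *-congˡ (⁻¹-anti-homo‿- (q j k) (q j t)) ⟩
      α * a i * (ε * r) * (q j t - q j k)
        ≈⟨ solve 4 (λ x y z w → x :* y :* z :* w := x :* (y :* w) :* z)
                   refl α (a i) (ε * r) (q j t - q j k) ⟩
      α * (a i * (q j t - q j k)) * (ε * r)
        ≈⟨ *-congˡ (recip-unique d#0 d-inverse) ⟨
      α * (a i * (q j t - q j k)) * recip d d#0
        ∎

-- Division is by `recip`, which takes a proof of apartness from zero, so the conclusion supplies
-- that proof together with the formula.
proposition3 : ∀ {c ℓ₁ ℓ₂ ℓ₃} (K : OrderedField c ℓ₁ ℓ₂ ℓ₃) →
  let open OrderedField K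
      open Multigraphs K
  in ∀ {n} (G G′ : Multigraph n) (α : Carrier) (0<α : 0# < α)
     (k t : Fin n) → k ≢ t →
     (ε : Carrier) (ε#0 : ε # 0#) → DiffersInEdge k t ε G G′ →
     let q  = accessibility G 0<α
         q′ = accessibility G′ 0<α
         ρ  = forestDistance G 0<α
     in Σ[ d#0 ∈ (ρ k t + recip ε ε#0) # 0# ]
          (∀ i j → q′ i j - q i j
                     ≈ α * ((q i k - q i t) * (q j t - q j k)) * recip (ρ k t + recip ε ε#0) d#0)
proposition3 K G G′ α 0<α k t _ ε ε#0 diff =
  d#0 G G′ 0<α k t ε ε#0 diff , accessibility-update G G′ 0<α k t ε ε#0 diff
  where open AccessibilityUpdate K
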